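{- Let $\lambda$ be an infinite cardinal with $\lambda = \lambda^{\aleph_0}$. Then there is no universal group in $\mathcal{LN}_\lambda$; that is, there is no locally nilpotent group $G$ with $|G|\le\lambda$ such that every locally nilpotent group $H$ with $|H|\le \lambda$ can be embedded into $G$.
   Context: A group $G$ is locally nilpotent if every finitely generated subgroup of $G$ is nilpotent. $\mathcal{LN}_\lambda$ denotes the class of all locally nilpotent groups of cardinality at most $\lambda$. A group $G\in\mathcal{LN}_\lambda$ is called universal in $\mathcal{LN}_\lambda$ if for every $H\in\mathcal{LN}_\lambda$ there is an injective group homomorphism $H\to G$. -}

module Defs where

open import Level using (Level; _⊔_) renaming (suc to lsuc)
open import Algebra.Bundles using (Group)
open import Algebra.Morphism.Structures using (module GroupMorphisms)
open import Data.List.Base using (List)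
import Data.List.Membership.Setoid as Membership
open import Data.Nat.Base using (ℕ; zero; suc)
open import Data.Product using (Σ-syntax; ∃-syntax; _×_; _,_; proj₁; proj₂)
open import Function.Bundles using (Bijection; Injection)
open import Function.Relation.Binary.Setoid.Equality using (_⇨_)
open import Induction.WellFounded using (WellFounded)
open import Relation.Binary.Bundles using (Setoid; StrictTotalOrder)
import Relation.Binary.Construct.On as On
import Relation.Binary.PropositionalEquality as ≡
open import Relation.Nullary using (¬_)
open import Relation.Unary using (Pred)
open import Relation.Unary.Polymorphic using (U)

-- A set is a setoid throughout: _≈_ plays the role of equality, and the
-- cardinality of a group is that of its carrier modulo _≈_.

-- Cardinals are initial ordinals: well-orders that are not equinumerous with
-- any of their proper initial segments.

segment : {ℓ : Level} (O : StrictTotalOrder ℓ ℓ ℓ) →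
          StrictTotalOrder.Carrier O → Setoid ℓ ℓ
segment O a = On.setoid setoid (proj₁ {B = λ x → x < a})
  where
  open StrictTotalOrder O using (_<_; module Eq)
  open Eq using (setoid)

record Cardinal (ℓ : Level) : Set (lsuc ℓ) where
  field
    order : StrictTotalOrder ℓ ℓ ℓ

  open StrictTotalOrder order public using (Carrier; _≈_; _<_; module Eq)

  setoid : Setoid ℓ ℓ
  setoid = Eq.setoid

  field
    wellFounded : WellFounded _<_
    initial     : ∀ a → ¬ Bijection setoid (segment order a)

-- ℵ₀ ≤ κ
Infinite : {ℓ : Level} → Cardinal ℓ → Set ℓ
Infinite κ = Injection (≡.setoid ℕ) (Cardinal.setoid κ)

-- The underlying set of κ ^ ℵ₀: all functions ℕ → κ, compared pointwise.
_^ℵ₀ : {ℓ : Level} → Cardinal ℓ → Setoid ℓ ℓ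
κ ^ℵ₀ = ≡.setoid ℕ ⇨ Cardinal.setoid κ

module _ {c ℓ : Level} (G : Group c ℓ) where
  open Group G

  data Generated {p : Level} (S : Pred Carrier p) : Pred Carrier (c ⊔ ℓ ⊔ p) where
    gen  : ∀ {x} → S x → Generated S x
    unit : Generated S ε
    mul  : ∀ {x y} → Generated S x → Generated S y → Generated S (x ∙ y)
    inv  : ∀ {x} → Generated S x → Generated S (x ⁻¹)
    resp : ∀ {x y} → x ≈ y → Generated S x → Generated S y

  generatedSubgroup : {p : Level} → Pred Carrier p → Group (c ⊔ ℓ ⊔ p) ℓ
  generatedSubgroup S = record
    { Carrier = Σ[ x ∈ Carrier ] Generated S x
    ; _≈_     = λ x y → proj₁ x ≈ proj₁ y
    ; _∙_     = λ (x , p) (y , q) → x ∙ y , mul p q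
    ; ε       = ε , unit
    ; _⁻¹     = λ (x , p) → x ⁻¹ , inv p
    ; isGroup = record
      { isMonoid = record
        { isSemigroup = record
          { isMagma = record
            { isEquivalence = On.isEquivalence proj₁ isEquivalence
            ; ∙-cong        = ∙-cong
            }
          ; assoc = λ (x , _) (y , _) (z , _) → assoc x y z
          }
        ; identity = (λ (x , _) → identityˡ x) , (λ (x , _) → identityʳ x)
        }
      ; inverse = (λ (x , _) → inverseˡ x) , (λ (x , _) → inverseʳ x)
      ; ⁻¹-cong = ⁻¹-cong
      }
    }

  [_,_] : Carrier → Carrier → Carrier
  [ x , y ] = x ⁻¹ ∙ y ⁻¹ ∙ x ∙ y

  -- γ 0 is the whole group and γ (n + 1) = [γ n , G], so indices are shifted
  -- by one from the convention in which γ₁ = G.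
  lowerCentralSeries : ℕ → Pred Carrier (c ⊔ ℓ)
  lowerCentralSeries zero    = U
  lowerCentralSeries (suc n) =
    Generated λ z → ∃[ x ] ∃[ y ] (lowerCentralSeries n x × z ≈ [ x , y ])

  Nilpotent : Set (c ⊔ ℓ)
  Nilpotent = ∃[ n ] (∀ x → lowerCentralSeries n x → x ≈ ε)

LocallyNilpotent : {c ℓ : Level} → Group c ℓ → Set (c ⊔ ℓ)
LocallyNilpotent G =
  (xs : List Carrier) → Nilpotent (generatedSubgroup G (λ x → x ∈ xs))
  where
  open Group G using (Carrier; setoid)
  open Membership setoid using (_∈_)

record LN {ℓ : Level} (κ : Cardinal ℓ) (G : Group ℓ ℓ) : Set ℓ where
  field
    locallyNilpotent : LocallyNilpotent G
    cardinality≤     : Injection (Group.setoid G) (Cardinal.setoid κ)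

Embeds : {ℓ : Level} → Group ℓ ℓ → Group ℓ ℓ → Set ℓ
Embeds H G = ∃[ f ] IsGroupMonomorphism f
  where open GroupMorphisms (Group.rawGroup H) (Group.rawGroup G)

UniversalLN : {ℓ : Level} → Cardinal ℓ → Group ℓ ℓ → Set (lsuc ℓ)
UniversalLN κ G = LN κ G × (∀ H → LN κ H → Embeds H G)

{-# OPTIONS --safe #-}
module Submission where

-- Suppose G is universal.  In a locally nilpotent group there are no η : ℕ → G
-- and y₀, y₁ such that every η n is nontrivial, [η n , y₀] = η (n + 1) for even
-- n and [η n , y₁] = η (n + 1) for odd n, as η n would lie in the n-th term of the
-- lower central series of ⟨η 0 , y₀ , y₁⟩.  So each η with nontrivial terms has
-- a parity (its colour) for which no y ∈ G does this.  Build a locally nilpotent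
-- group H on x_ν, for ν a finite sequence in G, and y_η, for η an infinite one,
-- such that [x_ν , y_η] = x_ν′ whenever ν ⊂ ν′ are successive initial segments
-- of η and the length of ν has the colour of η; then |H| ≤ κ ^ ℵ₀ = κ.  Along an
-- embedding f : H → G the branch η n = f (x_{η|n}) contradicts its colour.
-- H acts on F₂-valued functions on the finite sequences and one extra point, with
-- every x_ν and y_η an involution φ ↦ φ + φ ∘ e for a partial map e.  It is locally
-- nilpotent because different branches part at some level and a single branch
-- only uses every second edge, so that finitely many e compose only boundedly often.

open import Defs
open import Level using (Level)
open import Algebra.Bundles using (Group)
open import Algebra.Morphism.Structures using (module GroupMorphisms)
open import Axiom.ExcludedMiddle using (ExcludedMiddle)
open import Data.Bool.Base using (Bool; true; false; not; _xor_)
open import Data.Bool.Properties using (xor-comm; xor-identityʳ; xor-same; not-¬)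
open import Data.Bool.Solver using (module xor-∧-Solver)
open import Data.List.Base using (List; []; _∷_; _++_; concat; length; reverse)
import Data.List.Membership.Setoid as Membership
open import Data.List.Membership.Propositional using (_∈_; find; lose)
open import Data.List.Properties using (++-assoc; ++-identityʳ; reverse-++; reverse-involutive; unfold-reverse)
open import Data.List.Relation.Binary.Pointwise as List using (Pointwise; []; _∷_; Pointwise-length)
open import Data.List.Relation.Unary.All as All using (All; []; _∷_)
import Data.List.Relation.Unary.All.Properties as All
open import Data.List.Relation.Unary.Any using (Any; here; there)
open import Data.Maybe.Base using (Maybe; just; nothing; maybe)
open import Data.Maybe.Relation.Binary.Pointwise as Maybe using (just; nothing)
open import Data.Nat.Base using (ℕ; zero; suc; _+_; _∸_; _⊔_; _<_; _≤_; z≤n; s≤s)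
open import Data.Nat.Properties using (+-assoc; +-comm; +-mono-≤; +-monoʳ-≤; +-∸-assoc; m∸n≤m; m≤m+n; m≤n+m; m≤m⊔n; m≤n⊔m; m≤n⇒m<n∨m≡n; m≤n⇒m∸n≡0; m≤n⇒m≤1+n; n≤1+n; ≤-refl; ≤-reflexive; ≤-trans; ≤-<-connex; module ≤-Reasoning)
open import Data.Product using (Σ-syntax; ∃-syntax; ∃₂; _×_; _,_; proj₁; proj₂)
open import Data.Sum.Base using (inj₁; inj₂)
open import Data.Unit.Polymorphic using (⊤; tt)
open import Function.Base using (_∘_)
open import Function.Bundles using (Bijection; Injection; Func)
open import Induction.WellFounded using (Acc; acc)
open import Relation.Binary.Bundles using (Setoid; StrictTotalOrder)
open import Relation.Binary.Core using (Rel)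
open import Relation.Binary.Definitions using (tri<; tri≈; tri>)
open import Relation.Binary.PropositionalEquality as ≡ using (_≡_; refl; sym; trans; cong; cong₂; subst; module ≡-Reasoning)
open import Relation.Nullary using (¬_; Dec; does; yes; no; contradiction)

-- Groups of involutions on F₂-valued functions.

module TransvectionGroup {ℓ : Level} (P : Setoid ℓ ℓ) (Gen : Set ℓ)
  (edge : Gen → Setoid.Carrier P → Maybe (Setoid.Carrier P))
  (edge-cong : ∀ g {p q} → Setoid._≈_ P p q →
               Maybe.Pointwise (Setoid._≈_ P) (edge g p) (edge g q))
  (edge-edge : ∀ g {p q} → edge g p ≡ just q → edge g q ≡ nothing)
  where

  open Setoid P using () renaming (Carrier to Point)
  open Func using (to)

  Vector : Set ℓ
  Vector = Func P (≡.setoid Bool)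

  infix 4 _≗_
  _≗_ : Vector → Vector → Set ℓ
  φ ≗ ψ = ∀ p → to φ p ≡ to ψ p

  infixl 6 _⊕_
  _⊕_ : Vector → Vector → Vector
  φ ⊕ ψ = record
    { to   = λ p → to φ p xor to ψ p
    ; cong = λ p≈q → cong₂ _xor_ (Func.cong φ p≈q) (Func.cong ψ p≈q)
    }

  value : Vector → Maybe Point → Bool
  value φ = maybe (to φ) false

  value-cong : ∀ φ {p q} → Maybe.Pointwise (Setoid._≈_ P) p q → value φ p ≡ value φ q
  value-cong φ (just p≈q) = Func.cong φ p≈q
  value-cong φ nothing    = refl

  transvect : Gen → Vector → Vector
  transvect g φ = record
    { to   = λ p → to φ p xor value φ (edge g p)
    ; cong = λ p≈q → cong₂ _xor_ (Func.cong φ p≈q) (value-cong φ (edge-cong g p≈q))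
    }

  Word : Set ℓ
  Word = List Gen

  act : Word → Vector → Vector
  act []      φ = φ
  act (g ∷ w) φ = transvect g (act w φ)

  transvect-cong : ∀ g {φ ψ} → φ ≗ ψ → transvect g φ ≗ transvect g ψ
  transvect-cong g {φ} {ψ} φ≗ψ p = cong₂ _xor_ (φ≗ψ p) (aux (edge g p))
    where
    aux : ∀ q → value φ q ≡ value ψ q
    aux (just q) = φ≗ψ q
    aux nothing  = refl

  act-cong : ∀ w {φ ψ} → φ ≗ ψ → act w φ ≗ act w ψ
  act-cong []      φ≗ψ = φ≗ψ
  act-cong (g ∷ w) {φ} {ψ} φ≗ψ =
    transvect-cong g {act w φ} {act w ψ} (act-cong w {φ} {ψ} φ≗ψ)

  transvect-⊕ : ∀ g φ ψ → transvect g (φ ⊕ ψ) ≗ transvect g φ ⊕ transvect g ψ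
  transvect-⊕ g φ ψ p = trans
    (cong ((to φ p xor to ψ p) xor_) (aux (edge g p)))
    (interchange (to φ p) (to ψ p) (value φ (edge g p)) (value ψ (edge g p)))
    where
    aux : ∀ q → value (φ ⊕ ψ) q ≡ value φ q xor value ψ q
    aux (just q) = refl
    aux nothing  = refl

    interchange : ∀ a b c d → (a xor b) xor (c xor d) ≡ (a xor c) xor (b xor d)
    interchange = solve 4 (λ a b c d → (a :+ b) :+ (c :+ d) := (a :+ c) :+ (b :+ d)) refl
      where open xor-∧-Solver

  act-⊕ : ∀ w φ ψ → act w (φ ⊕ ψ) ≗ act w φ ⊕ act w ψ
  act-⊕ []      φ ψ p = refl
  act-⊕ (g ∷ w) φ ψ p = trans
    (transvect-cong g {act w (φ ⊕ ψ)} {act w φ ⊕ act w ψ} (act-⊕ w φ ψ) p)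
    (transvect-⊕ g (act w φ) (act w ψ) p)

  act-++ : ∀ w v φ → act (w ++ v) φ ≡ act w (act v φ)
  act-++ []      v φ = refl
  act-++ (g ∷ w) v φ = cong (transvect g) (act-++ w v φ)

  xor-cancelʳ : ∀ a b → (a xor b) xor b ≡ a
  xor-cancelʳ = solve 2 (λ a b → (a :+ b) :+ b := a) refl
    where open xor-∧-Solver

  -- Write the transvection as 1 + N with N φ = φ ∘ `edge g`, read as `false` where undefined. Over
  -- F₂ its square is 1 + N², and `edge-edge` says that N² = 0.
  transvect-involutive : ∀ g φ → transvect g (transvect g φ) ≗ φ
  transvect-involutive g φ p with edge g p in eq
  ... | nothing = trans (xor-identityʳ _) (xor-identityʳ _)
  ... | just q rewrite edge-edge g eq =
    trans (cong ((to φ p xor to φ q) xor_) (xor-identityʳ _)) (xor-cancelʳ (to φ p) (to φ q))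

  act-reverseˡ : ∀ w φ → act (reverse w) (act w φ) ≗ φ
  act-reverseˡ []      φ p = refl
  act-reverseˡ (g ∷ w) φ p = begin
    to (act (reverse (g ∷ w)) ψ) p                        ≡⟨ cong (λ v → to (act v ψ) p) (unfold-reverse g w) ⟩
    to (act (reverse w ++ g ∷ []) ψ) p                    ≡⟨ cong (λ χ → to χ p) (act-++ (reverse w) (g ∷ []) ψ) ⟩
    to (act (reverse w) (transvect g ψ)) p                ≡⟨ act-cong (reverse w) {transvect g ψ} {act w φ} (transvect-involutive g (act w φ)) p ⟩
    to (act (reverse w) (act w φ)) p                      ≡⟨ act-reverseˡ w φ p ⟩
    to φ p                                                ∎
    where
    open ≡-Reasoning
    ψ = transvect g (act w φ)

  act-reverseʳ : ∀ w φ → act w (act (reverse w) φ) ≗ φ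
  act-reverseʳ w φ p =
    trans (cong (λ v → to (act v (act (reverse w) φ)) p) (sym (reverse-involutive w)))
          (act-reverseˡ (reverse w) φ p)

  infix 4 _≋_
  -- Comparing words by their action makes `group` the group of operators generated by the
  -- transvections. Inverses are then reversed words, every generator being an involution.
  _≋_ : Word → Word → Set ℓ
  w ≋ v = ∀ φ → act w φ ≗ act v φ

  ++-cong : ∀ {w w′ v v′} → w ≋ w′ → v ≋ v′ → w ++ v ≋ w′ ++ v′
  ++-cong {w} {w′} {v} {v′} w≋w′ v≋v′ φ p
    rewrite act-++ w v φ | act-++ w′ v′ φ =
    trans (act-cong w {act v φ} {act v′ φ} (v≋v′ φ) p) (w≋w′ (act v′ φ) p)

  ≋-reflexive : ∀ {w v} → w ≡ v → w ≋ v
  ≋-reflexive refl φ p = refl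

  reverse-inverseˡ : ∀ w → reverse w ++ w ≋ []
  reverse-inverseˡ w φ p rewrite act-++ (reverse w) w φ = act-reverseˡ w φ p

  reverse-inverseʳ : ∀ w → w ++ reverse w ≋ []
  reverse-inverseʳ w φ p rewrite act-++ w (reverse w) φ = act-reverseʳ w φ p

  reverse-cong : ∀ {w v} → w ≋ v → reverse w ≋ reverse v
  reverse-cong {w} {v} w≋v φ p = begin
    to (act (reverse w) φ) p                            ≡⟨ act-cong (reverse w) {φ} {act v ψ} (λ q → sym (act-reverseʳ v φ q)) p ⟩
    to (act (reverse w) (act v ψ)) p                    ≡⟨ act-cong (reverse w) {act v ψ} {act w ψ} (λ q → sym (w≋v ψ q)) p ⟩
    to (act (reverse w) (act w ψ)) p                    ≡⟨ act-reverseˡ w ψ p ⟩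
    to ψ p                                              ∎
    where
    open ≡-Reasoning
    ψ = act (reverse v) φ

  group : Group ℓ ℓ
  group = record
    { Carrier = Word
    ; _≈_     = _≋_
    ; _∙_     = _++_
    ; ε       = []
    ; _⁻¹     = reverse
    ; isGroup = record
      { isMonoid = record
        { isSemigroup = record
          { isMagma = record
            { isEquivalence = record
              { refl  = λ φ p → refl
              ; sym   = λ w≋v φ p → sym (w≋v φ p)
              ; trans = λ u≋v v≋w φ p → trans (u≋v φ p) (v≋w φ p)
              }
            ; ∙-cong = λ {w} {w′} {v} {v′} → ++-cong {w} {w′} {v} {v′}
            }
          ; assoc = λ u v w → ≋-reflexive (++-assoc u v w)
          }
        ; identity = (λ w φ p → refl) , (λ w → ≋-reflexive (++-identityʳ w))
        }
      ; inverse = reverse-inverseˡ , reverse-inverseʳ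
      ; ⁻¹-cong = λ {w} {v} → reverse-cong {w} {v}
      }
    }

  -- Nilpotency from a bounded rank function.

  module Filtration (ρ : Point → ℕ) where

    Vanishes : ℕ → Vector → Set ℓ
    Vanishes m φ = ∀ p → ρ p < m → to φ p ≡ false

    vanishes-resp : ∀ {m φ ψ} → φ ≗ ψ → Vanishes m φ → Vanishes m ψ
    vanishes-resp φ≗ψ v p ρp<m = trans (sym (φ≗ψ p)) (v p ρp<m)

    vanishes-⊕ : ∀ {m φ ψ} → Vanishes m φ → Vanishes m ψ → Vanishes m (φ ⊕ ψ)
    vanishes-⊕ v v′ p ρp<m = cong₂ _xor_ (v p ρp<m) (v′ p ρp<m)

    vanishes-weaken : ∀ {m j φ} → Vanishes (m + j) φ → Vanishes m φ
    vanishes-weaken v p ρp<m = v p (≤-trans ρp<m (m≤m+n _ _))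

    -- Over F₂ the vector `act w φ ⊕ φ` is (w - 1) φ, so this is the analogue of a unitriangular
    -- matrix whose first j - 1 superdiagonals vanish.
    Raises : ℕ → Word → Set ℓ
    Raises j w = ∀ m φ → Vanishes m φ → Vanishes (m + j) (act w φ ⊕ φ)

    Preserves : Word → Set ℓ
    Preserves w = ∀ m φ → Vanishes m φ → Vanishes m (act w φ)

    raises⇒preserves : ∀ {j} w → Raises j w → Preserves w
    raises⇒preserves w r m φ v =
      vanishes-resp {m} {(act w φ ⊕ φ) ⊕ φ} {act w φ} (λ p → xor-cancelʳ (to (act w φ) p) (to φ p))
        (vanishes-⊕ {m} {act w φ ⊕ φ} {φ} (vanishes-weaken {m} {_} {act w φ ⊕ φ} (r m φ v)) v)

    raises-resp : ∀ {j w v} → w ≋ v → Raises j w → Raises j v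
    raises-resp {w = w} {v} w≋v r m φ z =
      vanishes-resp {_} {act w φ ⊕ φ} {act v φ ⊕ φ} (λ p → cong (_xor to φ p) (w≋v φ p)) (r m φ z)

    raises-[] : ∀ j → Raises j []
    raises-[] j m φ v p _ = xor-same (to φ p)

    -- wv - 1 = (w - 1)v + (v - 1), and v preserves the filtration.
    raises-++ : ∀ {j} w v → Raises j w → Raises j v → Raises j (w ++ v)
    raises-++ {j} w v rw rv m φ z =
      vanishes-resp {_} {(act w ψ ⊕ ψ) ⊕ (ψ ⊕ φ)} {act (w ++ v) φ ⊕ φ}
        (λ p → trans (telescope (to (act w ψ) p) (to ψ p) (to φ p))
                     (cong (λ χ → to χ p xor to φ p) (sym (act-++ w v φ))))
        (vanishes-⊕ {_} {act w ψ ⊕ ψ} {ψ ⊕ φ}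
          (rw m ψ (raises⇒preserves v rv m φ z)) (rv m φ z))
      where
      ψ = act v φ
      telescope : ∀ a b c → (a xor b) xor (b xor c) ≡ a xor c
      telescope = solve 3 (λ a b c → (a :+ b) :+ (b :+ c) := a :+ c) refl
        where open xor-∧-Solver

    -- Over F₂, w⁻¹ - 1 = w⁻¹(w - 1).
    raises-reverse : ∀ {j} w → Preserves (reverse w) → Raises j w → Raises j (reverse w)
    raises-reverse w pres r m φ v =
      vanishes-resp {_} {act w⁻¹ (act w φ ⊕ φ)} {act w⁻¹ φ ⊕ φ}
        (λ p → begin
          to (act w⁻¹ (act w φ ⊕ φ)) p                  ≡⟨ act-⊕ w⁻¹ (act w φ) φ p ⟩
          to (act w⁻¹ (act w φ)) p xor to (act w⁻¹ φ) p ≡⟨ cong (_xor to (act w⁻¹ φ) p) (act-reverseˡ w φ p) ⟩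
          to φ p xor to (act w⁻¹ φ) p                   ≡⟨ xor-comm (to φ p) _ ⟩
          to (act w⁻¹ φ) p xor to φ p                   ∎)
        (pres _ (act w φ ⊕ φ) (r m φ v))
      where
      open ≡-Reasoning
      w⁻¹ = reverse w

    -- [a,b] − 1 = a⁻¹b⁻¹(ab − ba) and ab − ba = (a − 1)(b − 1) − (b − 1)(a − 1).
    raises-commutator : ∀ {i j} a b → Preserves (reverse a) → Preserves (reverse b) →
                        Raises i a → Raises j b → Raises (i + j) ([_,_] group a b)
    raises-commutator {i} {j} a b pa pb ra rb m φ v =
      vanishes-resp {_} {act a⁻¹ (act b⁻¹ (δ ⊕ δ′))} {act [a,b] φ ⊕ φ} difference
        (pa _ (act b⁻¹ (δ ⊕ δ′)) (pb _ (δ ⊕ δ′) (vanishes-⊕ {_} {δ} {δ′}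
          (subst (λ k → Vanishes k δ) (trans (+-assoc m j i) (cong (m +_) (+-comm j i))) (ra _ β (rb m φ v)))
          (subst (λ k → Vanishes k δ′) (+-assoc m i j) (rb _ α (ra m φ v))))))
      where
      open ≡-Reasoning
      a⁻¹ = reverse a
      b⁻¹ = reverse b
      [a,b] = [_,_] group a b
      α = act a φ ⊕ φ
      β = act b φ ⊕ φ
      δ = act a β ⊕ β
      δ′ = act b α ⊕ α
      ab = act a (act b φ)
      ba = act b (act a φ)

      collect : ∀ x y u v w → ((x xor u) xor (v xor w)) xor ((y xor v) xor (u xor w)) ≡ x xor y
      collect = solve 5 (λ x y u v w → ((x :+ u) :+ (v :+ w)) :+ ((y :+ v) :+ (u :+ w)) := x :+ y) refl
        where open xor-∧-Solver

      δ⊕δ′ : δ ⊕ δ′ ≗ ab ⊕ ba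
      δ⊕δ′ p = trans
        (cong₂ _xor_ (cong (_xor to β p) (act-⊕ a (act b φ) φ p))
                     (cong (_xor to α p) (act-⊕ b (act a φ) φ p)))
        (collect (to ab p) (to ba p) (to (act a φ) p) (to (act b φ) p) (to φ p))

      conj : Vector → Vector
      conj χ = act a⁻¹ (act b⁻¹ χ)

      conj-cong : ∀ {χ χ′} → χ ≗ χ′ → conj χ ≗ conj χ′
      conj-cong {χ} {χ′} e = act-cong a⁻¹ {act b⁻¹ χ} {act b⁻¹ χ′} (act-cong b⁻¹ {χ} {χ′} e)

      act-[a,b] : act [a,b] φ ≡ conj ab
      act-[a,b] = trans (act-++ ((a⁻¹ ++ b⁻¹) ++ a) b φ)
        (trans (act-++ (a⁻¹ ++ b⁻¹) a (act b φ)) (act-++ a⁻¹ b⁻¹ ab))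

      difference : conj (δ ⊕ δ′) ≗ act [a,b] φ ⊕ φ
      difference p = begin
        to (conj (δ ⊕ δ′)) p                     ≡⟨ conj-cong {δ ⊕ δ′} {ab ⊕ ba} δ⊕δ′ p ⟩
        to (conj (ab ⊕ ba)) p                    ≡⟨ act-cong a⁻¹ {act b⁻¹ (ab ⊕ ba)} {act b⁻¹ ab ⊕ act b⁻¹ ba} (act-⊕ b⁻¹ ab ba) p ⟩
        to (act a⁻¹ (act b⁻¹ ab ⊕ act b⁻¹ ba)) p ≡⟨ act-⊕ a⁻¹ (act b⁻¹ ab) (act b⁻¹ ba) p ⟩
        to (conj ab) p xor to (conj ba) p        ≡⟨ cong₂ _xor_ (cong (λ χ → to χ p) (sym act-[a,b]))
                                                      (trans (act-cong a⁻¹ {act b⁻¹ ba} {act a φ} (act-reverseˡ b (act a φ)) p)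
                                                             (act-reverseˡ a φ p)) ⟩
        to (act [a,b] φ) p xor to φ p            ∎

    Lowers : Gen → Set ℓ
    Lowers g = ∀ {p q} → edge g p ≡ just q → ρ q < ρ p

    -- Here (g - 1) φ is φ ∘ `edge g`, whose value at p is read at a point of smaller rank.
    raises-gen : ∀ {g} → Lowers g → Raises 1 (g ∷ [])
    raises-gen {g} low m φ v p ρp<m+1 =
      trans (cong (_xor to φ p) (xor-comm (to φ p) (value φ (edge g p))))
            (trans (xor-cancelʳ (value φ (edge g p)) (to φ p)) lowered)
      where
      lowered : value φ (edge g p) ≡ false
      lowered with edge g p in eq
      ... | nothing = refl
      ... | just q  with s≤s ρp≤m ← subst (ρ p <_) (+-comm m 1) ρp<m+1 = v q (≤-trans (low eq) ρp≤m)

    -- The reversed word is carried along because `raises-reverse` and `raises-commutator` ask that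
    -- inverses preserve the filtration.
    BothRaise : Word → Set ℓ
    BothRaise w = Raises 1 w × Raises 1 (reverse w)

    bothRaise-resp : ∀ {w v} → w ≋ v → BothRaise w → BothRaise v
    bothRaise-resp {w} {v} w≋v (r , r⁻¹) =
      raises-resp {w = w} {v} w≋v r ,
      raises-resp {w = reverse w} {reverse v} (reverse-cong {w} {v} w≋v) r⁻¹

    bothRaise-word : ∀ {w} → All Lowers w → BothRaise w
    bothRaise-word []                   = raises-[] 1 , raises-[] 1
    bothRaise-word {g ∷ w} (low ∷ lows) with bothRaise-word lows
    ... | rw , rw⁻¹ = raises-++ (g ∷ []) w (raises-gen low) rw ,
      subst (Raises 1) (sym (unfold-reverse g w)) (raises-++ (reverse w) (g ∷ []) rw⁻¹ (raises-gen low))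

    bothRaise-generated : ∀ {p} {S : Word → Set p} → (∀ {w} → S w → BothRaise w) →
                          ∀ {w} → Generated group S w → BothRaise w
    bothRaise-generated h (gen s)               = h s
    bothRaise-generated h unit                  = raises-[] 1 , raises-[] 1
    bothRaise-generated h (mul {w} {v} gw gv) with bothRaise-generated h gw | bothRaise-generated h gv
    ... | rw , rw⁻¹ | rv , rv⁻¹ = raises-++ w v rw rv ,
      subst (Raises 1) (sym (reverse-++ w v)) (raises-++ (reverse v) (reverse w) rv⁻¹ rw⁻¹)
    bothRaise-generated h (inv {w} gw) with bothRaise-generated h gw
    ... | rw , rw⁻¹ = rw⁻¹ , subst (Raises 1) (sym (reverse-involutive w)) rw
    bothRaise-generated h (resp {w} {v} w≋v gw) = bothRaise-resp {w} {v} w≋v (bothRaise-generated h gw)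

    module _ {p} {S : Word → Set p} (h : ∀ {w} → S w → BothRaise w) where

      private
        K = generatedSubgroup group S

        preserves⁻¹ : (x : Group.Carrier K) → Preserves (reverse (proj₁ x))
        preserves⁻¹ (w , gw) = raises⇒preserves (reverse w) (proj₂ (bothRaise-generated h gw))

      -- Members of the subgroup raise by 1, and by `raises-commutator` each further commutator with
      -- one of them adds 1. The index is `suc n` because the series starts with the whole group at
      -- 0.
      raises-lowerCentralSeries : ∀ n {x} → lowerCentralSeries K n x → Raises (suc n) (proj₁ x)
      raises-lowerCentralSeries zero {w , gw} _ = proj₁ (bothRaise-generated h gw)
      raises-lowerCentralSeries (suc n) (gen {z} (x , y , γx , z≋[x,y])) =
        raises-resp {w = [_,_] group (proj₁ x) (proj₁ y)} {proj₁ z} (λ φ p → sym (z≋[x,y] φ p))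
          (subst (λ k → Raises k ([_,_] group (proj₁ x) (proj₁ y))) (+-comm (suc n) 1)
            (raises-commutator (proj₁ x) (proj₁ y) (preserves⁻¹ x) (preserves⁻¹ y)
              (raises-lowerCentralSeries n γx) (proj₁ (bothRaise-generated h (proj₂ y)))))
      raises-lowerCentralSeries (suc n) unit = raises-[] _
      raises-lowerCentralSeries (suc n) (mul {x} {y} γx γy) =
        raises-++ (proj₁ x) (proj₁ y) (raises-lowerCentralSeries (suc n) γx) (raises-lowerCentralSeries (suc n) γy)
      raises-lowerCentralSeries (suc n) (inv {x} γx) =
        raises-reverse (proj₁ x) (preserves⁻¹ x) (raises-lowerCentralSeries (suc n) γx)
      raises-lowerCentralSeries (suc n) (resp {x} {y} x≋y γx) =
        raises-resp {w = proj₁ x} {proj₁ y} x≋y (raises-lowerCentralSeries (suc n) γx)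

      -- Every vector vanishes below rank 0, so for w in term `M` the vector (w - 1) φ vanishes
      -- below rank `suc M`, which is everywhere.
      nilpotent : ∀ M → (∀ p → ρ p < M) → Nilpotent K
      nilpotent M ρ<M = M , λ { (w , gw) γw φ p →
        let vanish = raises-lowerCentralSeries M {w , gw} γw 0 φ (λ _ ()) p (≤-trans (ρ<M p) (m≤n+m M 1))
        in xor-false (to (act w φ) p) (to φ p) vanish }
        where
        xor-false : ∀ a b → a xor b ≡ false → a ≡ b
        xor-false false b     e = sym e
        xor-false true  true  e = refl

  -- Finitely many words involve only the finitely many generators in `concat ws`, and the rank may
  -- be chosen after these are known.
  locallyNilpotent :
    (∀ (gs : List Gen) → ∃₂ λ ρ M →
      (∀ p → ρ p < M) × All (Filtration.Lowers ρ) gs) → LocallyNilpotent group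
  locallyNilpotent ranked ws with ranked (concat ws)
  ... | ρ , M , ρ<M , lows = nilpotent {S = λ w → Membership._∈_ (Group.setoid group) w ws}
      (λ {w} → All.lookupₛ (Group.setoid group) (λ {w} {v} → bothRaise-resp {w} {v})
        (All.map bothRaise-word (All.concat⁻ lows)) {w}) M ρ<M
    where
    open Filtration ρ

-- Parity and uniform bounds.

parity : ℕ → Bool
parity zero    = false
parity (suc n) = not (parity n)

common-bound : ∀ {a q} {A : Set a} (Q : A → ℕ → Set q) → (∀ {x m n} → m ≤ n → Q x m → Q x n) →
               (∀ x → ∃[ n ] Q x n) → ∀ xs → ∃[ n ] All (λ x → Q x n) xs
common-bound Q mono bound []       = 0 , []
common-bound Q mono bound (x ∷ xs) with bound x | common-bound Q mono bound xs
... | m , q | n , qs = m ⊔ n , mono (m≤m⊔n m n) q ∷ All.map (mono (m≤n⊔m m n)) qs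

-- The locally nilpotent group of a coloured tree.

module TreeGroup {ℓ : Level} (em : ExcludedMiddle ℓ) (A : Setoid ℓ ℓ)
  (colour : (ℕ → Setoid.Carrier A) → Bool)
  (colour-cong : ∀ {η θ} → (∀ n → Setoid._≈_ A (η n) (θ n)) → colour η ≡ colour θ)
  where

  open Setoid A using (_≈_) renaming (Carrier to Label)
  private module A = Setoid A

  -- Nodes list their labels from the leaf to the root.
  Node Branch : Set ℓ
  Node   = List Label
  Branch = ℕ → Label

  -- The point `nothing` supports the translations: x ν adds φ (just ν) to φ nothing.
  points : Setoid ℓ ℓ
  points = Maybe.setoid (List.setoid A)

  open Setoid points using () renaming (Carrier to Point; _≈_ to _≈ₚ_)

  On : Node → Branch → Set ℓ
  On []      η = ⊤
  On (a ∷ ν) η = a ≈ η (length ν) × On ν η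

  child : Branch → Node → Node
  child η ν = η (length ν) ∷ ν

  Active : Branch → Node → Set ℓ
  Active η ν = On ν η × parity (length ν) ≡ colour η

  data Generator : Set ℓ where
    node   : Node → Generator
    branch : Branch → Generator

  -- Labels form a setoid, and generators with equivalent labels act alike. This relation is the one
  -- up to which generators are later coded by elements of κ.
  data _∼_ : Generator → Generator → Set ℓ where
    node   : ∀ {μ ν} → Pointwise _≈_ μ ν → node μ ∼ node ν
    branch : ∀ {η θ} → (∀ n → η n ≈ θ n) → branch η ∼ branch θ

  -- With the decision as an argument, `ρ-lowers` can replace `em` by its outcome through `cong`.
  follow : ∀ η ν → Dec (Active η ν) → Maybe Point
  follow η ν (yes _) = just (just (child η ν))
  follow η ν (no _)  = nothing

  edge : Generator → Point → Maybe Point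
  edge (node ν)   nothing  = just (just ν)
  edge (node ν)   (just _) = nothing
  edge (branch η) nothing  = nothing
  edge (branch η) (just ν) = follow η ν em

  On-resp : ∀ {η θ μ ν} → (∀ n → η n ≈ θ n) → Pointwise _≈_ μ ν → On μ η → On ν θ
  On-resp         η≈θ []          _          = tt
  On-resp {η} {θ} η≈θ (a≈b ∷ μ≈ν) (a≈η , on) =
    A.trans (A.sym a≈b) (A.trans a≈η (A.trans (η≈θ _) (A.reflexive (cong θ (Pointwise-length μ≈ν))))) ,
    On-resp η≈θ μ≈ν on

  Active-resp : ∀ {η θ μ ν} → (∀ n → η n ≈ θ n) → Pointwise _≈_ μ ν → Active η μ → Active θ ν
  Active-resp η≈θ μ≈ν (on , par) = On-resp η≈θ μ≈ν on ,
    trans (cong parity (sym (Pointwise-length μ≈ν))) (trans par (colour-cong η≈θ))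

  child-cong : ∀ {η θ μ ν} → (∀ n → η n ≈ θ n) → Pointwise _≈_ μ ν →
               Pointwise _≈_ (child η μ) (child θ ν)
  child-cong {θ = θ} η≈θ μ≈ν =
    A.trans (η≈θ _) (A.reflexive (cong θ (Pointwise-length μ≈ν))) ∷ μ≈ν

  edge-cong₂ : ∀ {g h p q} → g ∼ h → p ≈ₚ q → Maybe.Pointwise _≈ₚ_ (edge g p) (edge h q)
  edge-cong₂ (node μ≈ν)   nothing  = just (just μ≈ν)
  edge-cong₂ (node μ≈ν)   (just _) = nothing
  edge-cong₂ (branch η≈θ) nothing  = nothing
  edge-cong₂ (branch {η} {θ} η≈θ) (just {μ} {ν} μ≈ν) with em {Active η μ} | em {Active θ ν}
  ... | yes _  | yes _   = just (just (child-cong η≈θ μ≈ν))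
  ... | no  _  | no  _   = nothing
  ... | yes ac | no ¬ac  = contradiction (Active-resp η≈θ μ≈ν ac) ¬ac
  ... | no ¬ac | yes ac  = contradiction
    (Active-resp (λ n → A.sym (η≈θ n)) (List.symmetric A.sym μ≈ν) ac) ¬ac

  ∼-refl : ∀ g → g ∼ g
  ∼-refl (node ν)   = node (List.refl A.refl)
  ∼-refl (branch η) = branch (λ n → A.refl)

  -- The length changes parity from a node to its child, while the colour of η is fixed.
  ¬Active-child : ∀ {η ν} → Active η ν → ¬ Active η (child η ν)
  ¬Active-child {η} {ν} (_ , par) (_ , par′) = not-¬ refl (trans par (sym par′))

  edge-edge : ∀ g {p q} → edge g p ≡ just q → edge g q ≡ nothing
  edge-edge (node ν)   {nothing} refl = refl
  edge-edge (branch η) {just ν}  e with em {Active η ν}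
  edge-edge (branch η) {just ν}  refl | yes ac with em {Active η (child η ν)}
  ... | no _    = refl
  ... | yes ac′ = contradiction ac′ (¬Active-child ac)

  open TransvectionGroup points Generator edge (λ g → edge-cong₂ (∼-refl g)) edge-edge public

  Pointwise-∼⇒≋ : ∀ {w v} → Pointwise _∼_ w v → w ≋ v
  Pointwise-∼⇒≋ []                              φ p = refl
  Pointwise-∼⇒≋ (_∷_ {x = g} {xs = w} {ys = v} g∼h w∼v) φ p = trans
    (transvect-cong g {act w φ} {act v φ} (Pointwise-∼⇒≋ w∼v φ) p)
    (cong (Func.to (act v φ) p xor_) (value-cong (act v φ) (edge-cong₂ g∼h (Setoid.refl points))))

  x : Node → Word
  x ν = node ν ∷ []

  y : Branch → Word
  y η = branch η ∷ []

  -- On the constant vector `true`, `x ν` changes the value at `nothing` to `false`.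
  x≉ε : ∀ ν → ¬ x ν ≋ []
  x≉ε ν x≋ε with () ← x≋ε (record { to = λ _ → true ; cong = λ _ → refl }) nothing

  -- Both generators are their own reversals, so the commutator is the word xyxy. Only x changes the
  -- value at `nothing`, and y never reads that value; hence at the nodes the two y cancel. At
  -- `nothing` the two x contribute φ ν + φ (`child η ν`) and φ ν, with sum φ (`child η ν`).
  [x,y]≋x : ∀ {η ν} → Active η ν → [_,_] group (x ν) (y η) ≋ x (child η ν)
  [x,y]≋x {η} {ν} ac φ = agree
    where
    open Func using (to)
    open ≡-Reasoning

    agree-y : ∀ {χ χ′} → (∀ μ → to χ (just μ) ≡ to χ′ (just μ)) →
              ∀ μ → to (act (y η) χ) (just μ) ≡ to (act (y η) χ′) (just μ)
    agree-y χ≗χ′ μ with em {Active η μ}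
    ... | yes _ = cong₂ _xor_ (χ≗χ′ μ) (χ≗χ′ (child η μ))
    ... | no _  = cong₂ _xor_ (χ≗χ′ μ) refl

    yxy : ∀ μ → to (act (y η ++ x ν ++ y η) φ) (just μ) ≡ to φ (just μ)
    yxy μ = trans
      (agree-y {act (x ν ++ y η) φ} {act (y η) φ} (λ _ → xor-identityʳ _) μ)
      (transvect-involutive (branch η) φ (just μ))

    y-active : to (act (y η) φ) (just ν) ≡ to φ (just ν) xor to φ (just (child η ν))
    y-active with em {Active η ν}
    ... | yes _  = refl
    ... | no ¬ac = contradiction ac ¬ac

    cancel : ∀ a b c → (((a xor false) xor (b xor c)) xor false) xor b ≡ a xor c
    cancel = solve 3 (λ a b c → (((a :+ con false) :+ (b :+ c)) :+ con false) :+ b := a :+ c) refl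
      where open xor-∧-Solver

    agree : act ([_,_] group (x ν) (y η)) φ ≗ act (x (child η ν)) φ
    agree (just μ) = cong (_xor false) (yxy μ)
    agree nothing  = begin
      (((to φ nothing xor false) xor to (act (y η) φ) (just ν)) xor false)
        xor to (act (y η ++ x ν ++ y η) φ) (just ν)
        ≡⟨ cong₂ (λ b c → (((to φ nothing xor false) xor b) xor false) xor c) y-active (yxy ν) ⟩
      (((to φ nothing xor false) xor (to φ (just ν) xor to φ (just (child η ν)))) xor false) xor to φ (just ν)
        ≡⟨ cancel (to φ nothing) (to φ (just ν)) (to φ (just (child η ν))) ⟩
      to φ nothing xor to φ (just (child η ν)) ∎

  On-unique : ∀ {η θ n} ν → n < length ν → On ν η → On ν θ → η n ≈ θ n
  On-unique {n = n} (a ∷ ν) (s≤s n≤|ν|) (a≈η , onη) (a≈θ , onθ) with m≤n⇒m<n∨m≡n n≤|ν|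
  ... | inj₁ n<|ν| = On-unique ν n<|ν| onη onθ
  ... | inj₂ refl  = A.trans (A.sym a≈η) a≈θ

  Separated : Generator → Generator → ℕ → Set ℓ
  Separated g h L = ∀ {ν q} → L ≤ length ν → edge g (just ν) ≡ just q → edge h q ≡ nothing

  -- Distinct branches part at some level; equal ones have the same colour, hence
  -- are active at levels of one parity only.
  separated : ∀ g h → ∃[ L ] Separated g h L
  separated (node _)   h          = 0 , λ _ ()
  separated (branch η) (node θ)   = 0 , sep
    where
    sep : Separated (branch η) (node θ) 0
    sep {ν} _ e with em {Active η ν}
    sep     _ refl | yes _ = refl
  separated (branch η) (branch θ) with em {∃[ n ] ¬ η n ≈ θ n}
  ... | yes (n , η≉θ) = n , sep
    where
    sep : Separated (branch η) (branch θ) n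
    sep {ν} n≤|ν| e with em {Active η ν}
    sep {ν} n≤|ν| refl | yes (onη , _) with em {Active θ (child η ν)}
    ... | no _          = refl
    ... | yes (onθ , _) =
      contradiction (On-unique (child η ν) (s≤s n≤|ν|) (A.refl , onη) onθ) η≉θ
  ... | no ¬differ = 0 , sep
    where
    η≈θ : ∀ n → η n ≈ θ n
    η≈θ n with em {η n ≈ θ n}
    ... | yes e = e
    ... | no ¬e = contradiction (n , ¬e) ¬differ

    sep : Separated (branch η) (branch θ) 0
    sep {ν} _ e with em {Active η ν}
    sep {ν} _ refl | yes ac with em {Active θ (child η ν)}
    ... | no _    = refl
    ... | yes ac′ = contradiction
      (Active-resp (λ n → A.sym (η≈θ n)) (List.refl A.refl) ac′) (¬Active-child ac)

  -- A bounded rank lowered by finitely many generators.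

  module Rank (gs : List Generator) (L : ℕ)
    (sep : ∀ {g h} → g ∈ gs → h ∈ gs → Separated g h L) where

    Leaves : Node → Set ℓ
    Leaves ν = Any (λ g → ∃[ q ] edge g (just ν) ≡ just q) gs

    leaves : Node → ℕ
    leaves ν with em {Leaves ν}
    ... | yes _ = 1
    ... | no _  = 0

    leaves≤1 : ∀ ν → leaves ν ≤ 1
    leaves≤1 ν with em {Leaves ν}
    ... | yes _ = ≤-refl
    ... | no _  = z≤n

    leaves≡1 : ∀ {ν} → Leaves ν → leaves ν ≡ 1
    leaves≡1 {ν} l with em {Leaves ν}
    ... | yes _ = refl
    ... | no ¬l = contradiction l ¬l

    leaves≡0 : ∀ {ν} → ¬ Leaves ν → leaves ν ≡ 0
    leaves≡0 {ν} ¬l with em {Leaves ν}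
    ... | yes l = contradiction l ¬l
    ... | no _  = refl

    -- This bounds the length of a path of edges: `L ∸ length ν` steps down to level `L`, then at
    -- most one more, counted by `leaves`. The point `nothing` lies above all nodes since a
    -- generator `node ν` leads from it to an arbitrary node.
    ρ : Point → ℕ
    ρ nothing  = suc (suc L)
    ρ (just ν) = (L ∸ length ν) + leaves ν

    ρ-just : ∀ ν → ρ (just ν) < suc (suc L)
    ρ-just ν = s≤s (≤-trans (+-mono-≤ (m∸n≤m L (length ν)) (leaves≤1 ν)) (≤-reflexive (+-comm L 1)))

    ρ-bounded : ∀ p → ρ p < suc (suc (suc L))
    ρ-bounded nothing  = ≤-refl
    ρ-bounded (just ν) = ≤-trans (ρ-just ν) (n≤1+n _)

    dead-end : ∀ {g μ ν} → g ∈ gs → L ≤ length μ → edge g (just μ) ≡ just (just ν) → ¬ Leaves ν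
    dead-end g∈gs L≤|μ| e l with find l
    ... | h , h∈gs , _ , e′ with () ← trans (sym (sep g∈gs h∈gs L≤|μ| e)) e′

    -- The node itself has `leaves ν` equal to 1. From level `L` on its child is a dead end, so the
    -- rank drops from 1 to 0; above that level the distance to `L` drops by one, while `leaves`
    -- cannot exceed 1 at the child.
    ρ-child : ∀ {g ν} a → g ∈ gs → edge g (just ν) ≡ just (just (a ∷ ν)) →
              ρ (just (a ∷ ν)) < ρ (just ν)
    ρ-child {g} {ν} a g∈gs e
      rewrite leaves≡1 {ν} (lose g∈gs (_ , e)) | +-comm (L ∸ length ν) 1
      with ≤-<-connex L (length ν)
    ... | inj₁ L≤|ν| rewrite m≤n⇒m∸n≡0 L≤|ν| | m≤n⇒m∸n≡0 (m≤n⇒m≤1+n L≤|ν|)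
                           | leaves≡0 {a ∷ ν} (dead-end g∈gs L≤|ν| e) = ≤-refl
    ... | inj₂ |ν|<L = s≤s (begin
      (L ∸ suc (length ν)) + leaves (a ∷ ν) ≤⟨ +-monoʳ-≤ _ (leaves≤1 (a ∷ ν)) ⟩
      (L ∸ suc (length ν)) + 1              ≡⟨ +-comm _ 1 ⟩
      suc (L ∸ suc (length ν))              ≡⟨ +-∸-assoc 1 |ν|<L ⟨
      L ∸ length ν                          ∎)
      where open ≤-Reasoning

    ρ-lowers : ∀ {g} → g ∈ gs → Filtration.Lowers ρ g
    ρ-lowers {node ν}   g∈gs {nothing} refl = ρ-just ν
    ρ-lowers {branch η} g∈gs {just ν}  e with follow η ν em in eq | e
    ... | just q | refl with em {Active η ν} in emq | eq
    ...   | yes _ | refl = ρ-child (η (length ν)) g∈gs (cong (follow η ν) emq)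

  group-locallyNilpotent : LocallyNilpotent group
  group-locallyNilpotent = locallyNilpotent λ gs →
    -- One bound over each member of a pair yields a single level that separates all pairs from
    -- `gs`.
    let (L , sep) = common-bound (λ g L → All (λ h → Separated g h L) gs)
                      (λ {g} m≤n → All.map (λ {h} → weaken g h m≤n))
                      (λ g → common-bound (Separated g) (λ {h} → weaken g h) (separated g) gs) gs
        open Rank gs L (λ g∈ h∈ → All.lookup (All.lookup sep g∈) h∈)
    in ρ , _ , ρ-bounded , All.tabulate (λ g∈ {p} {q} → ρ-lowers g∈ {p} {q})
    where
    weaken : ∀ g h {m n} → m ≤ n → Separated g h m → Separated g h n
    weaken g h m≤n sep n≤|ν| = sep (≤-trans m≤n n≤|ν|)

-- Coding words by elements of κ.

module Coding {ℓ : Level} (em : ExcludedMiddle ℓ) (κ : Cardinal ℓ)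
  (infinite : Infinite κ) (κ≅κ^ℵ₀ : Bijection (Cardinal.setoid κ) (κ ^ℵ₀)) where

  open Cardinal κ using (Carrier; _≈_; wellFounded; order) renaming (setoid to κ-setoid; _<_ to _≺_)
  private
    module κ = Setoid κ-setoid
    module infinite = Injection infinite
    module κ≅κ^ℵ₀ = Bijection κ≅κ^ℵ₀

  -- Asking only that equality be reflected lets R be coarsened freely: words are coded up to
  -- `Pointwise _∼_` but compared by `_≋_`. Congruence is recovered in `code⇒injection`.
  Code : (A : Set ℓ) → Rel A ℓ → Set ℓ
  Code A R = Σ[ code ∈ (A → Carrier) ] (∀ {a b} → code a ≈ code b → R a b)

  -- The code is a preimage of the sequence of codes under κ → κ ^ ℵ₀; mapping it forward again
  -- recovers every entry.
  code-sequence : ∀ {A R} → Code A R → Code (ℕ → A) (λ s t → ∀ n → R (s n) (t n))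
  code-sequence {A} {R} (code , code-inj) = encode , λ {s} {t} e n →
    code-inj (κ.trans (κ.sym (decode-encode s n))
      (κ.trans (κ≅κ^ℵ₀.cong e n) (decode-encode t n)))
    where
    coded : (ℕ → A) → Setoid.Carrier (κ ^ℵ₀)
    coded s = record { to = code ∘ s ; cong = λ { refl → κ.refl } }

    encode : (ℕ → A) → Carrier
    encode s = κ≅κ^ℵ₀.to⁻ (coded s)

    decode-encode : ∀ s n → Func.to (κ≅κ^ℵ₀.to (encode s)) n ≈ code (s n)
    decode-encode s = proj₂ (κ≅κ^ℵ₀.strictlySurjective (coded s))

  private
    codes : Code (ℕ → Carrier) (λ s t → ∀ n → s n ≈ t n)
    codes = code-sequence ((λ a → a) , (λ e → e))

  -- A pairing function with a numeral tag, obtained by coding the sequence n, a, b, b, ...; entries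
  -- 0, 1 and 2 are read back.
  tagged : ℕ → Carrier → Carrier → Carrier
  tagged n a b = proj₁ codes λ { 0 → infinite.to n ; 1 → a ; _ → b }

  tagged-injective : ∀ {m n a b c d} → tagged m a b ≈ tagged n c d → m ≡ n × a ≈ c × b ≈ d
  tagged-injective e = infinite.injective (proj₂ codes e 0) , proj₂ codes e 1 , proj₂ codes e 2

  code-list : ∀ {A R} → Code A R → Code (List A) (Pointwise R)
  code-list {A} {R} (code , code-inj) = encode , λ {as} {bs} → encode-injective as bs
    where
    encode : List A → Carrier
    -- The tag tells empty from nonempty lists; `infinite.to 0` is an arbitrary filler.
    encode []       = tagged 0 (infinite.to 0) (infinite.to 0)
    encode (a ∷ as) = tagged 1 (code a) (encode as)

    encode-injective : ∀ as bs → encode as ≈ encode bs → Pointwise R as bs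
    encode-injective []       []       _ = []
    encode-injective []       (b ∷ bs) e with () ← proj₁ (tagged-injective e)
    encode-injective (a ∷ as) []       e with () ← proj₁ (tagged-injective e)
    encode-injective (a ∷ as) (b ∷ bs) e with tagged-injective e
    ... | _ , ea , eas = code-inj ea ∷ encode-injective as bs eas

  least : (Q : Carrier → Set ℓ) → ∀ {a} → Q a → ∃[ b ] Q b × (∀ c → Q c → ¬ c ≺ b)
  least Q {a} qa = go (wellFounded a) qa
    where
    go : ∀ {a} → Acc _≺_ a → Q a → ∃[ b ] Q b × (∀ c → Q c → ¬ c ≺ b)
    go {a} (acc below) qa with em {∃[ c ] Q c × c ≺ a}
    ... | yes (c , qc , c≺a) = go (below c≺a) qc
    ... | no none            = a , qa , λ c qc c≺a → none (c , qc , c≺a)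

  -- A code need not respect the equality of S; taking the least code of an
  -- equivalence class makes it do so.
  code⇒injection : (S : Setoid ℓ ℓ) → Code (Setoid.Carrier S) (Setoid._≈_ S) → Injection S κ-setoid
  code⇒injection S (code , code-inj) = record
    { to        = λ s → proj₁ (leastCode s)
    ; cong      = leastCode-cong
    ; injective = leastCode-injective
    }
    where
    module S = Setoid S

    Codes : S.Carrier → Carrier → Set ℓ
    Codes s a = ∃[ t ] t S.≈ s × code t ≈ a

    leastCode : ∀ s → ∃[ a ] Codes s a × (∀ b → Codes s b → ¬ b ≺ a)
    leastCode s = least (Codes s) (s , S.refl , κ.refl)

    leastCode-cong : ∀ {s t} → s S.≈ t → proj₁ (leastCode s) ≈ proj₁ (leastCode t)
    -- Equivalent elements have the same codes, so each minimum competes with the other and neither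
    -- can be smaller.
    leastCode-cong {s} {t} s≈t with leastCode s | leastCode t
    ... | a , (u , u≈s , ca) , a-least | b , (v , v≈t , cb) , b-least
      with StrictTotalOrder.compare order a b
    ... | tri< a≺b _ _ = contradiction a≺b (b-least a (u , S.trans u≈s s≈t , ca))
    ... | tri≈ _ a≈b _ = a≈b
    ... | tri> _ _ b≺a = contradiction b≺a (a-least b (v , S.trans v≈t (S.sym s≈t) , cb))

    leastCode-injective : ∀ {s t} → proj₁ (leastCode s) ≈ proj₁ (leastCode t) → s S.≈ t
    leastCode-injective {s} {t} a≈b with leastCode s | leastCode t
    ... | a , (u , u≈s , ca) , _ | b , (v , v≈t , cb) , _ =
      S.trans (S.sym u≈s) (S.trans (code-inj (κ.trans ca (κ.trans a≈b (κ.sym cb)))) v≈t)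

  module _ (A : Setoid ℓ ℓ) (A↣κ : Injection A κ-setoid)
    (colour : (ℕ → Setoid.Carrier A) → Bool)
    (colour-cong : ∀ {η θ} → (∀ n → Setoid._≈_ A (η n) (θ n)) → colour η ≡ colour θ)
    where

    open TreeGroup em A colour colour-cong
    private
      code-label : Code (Setoid.Carrier A) (Setoid._≈_ A)
      code-label = Injection.to A↣κ , Injection.injective A↣κ

    code-generator : Code Generator _∼_
    code-generator = encode , λ {g} {h} → encode-injective g h
      where
      encode : Generator → Carrier
      encode (node ν)   = tagged 0 (proj₁ (code-list code-label) ν) (infinite.to 0)
      encode (branch η) = tagged 1 (proj₁ (code-sequence code-label) η) (infinite.to 0)

      encode-injective : ∀ g h → encode g ≈ encode h → g ∼ h
      encode-injective (node μ)   (node ν)   e =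
        node (proj₂ (code-list code-label) (proj₁ (proj₂ (tagged-injective e))))
      encode-injective (node μ)   (branch θ) e with () ← proj₁ (tagged-injective e)
      encode-injective (branch η) (node ν)   e with () ← proj₁ (tagged-injective e)
      encode-injective (branch η) (branch θ) e =
        branch (proj₂ (code-sequence code-label) (proj₁ (proj₂ (tagged-injective e))))

    treeGroup∈LN : LN κ group
    treeGroup∈LN = record
      { locallyNilpotent = group-locallyNilpotent
      ; cardinality≤     = code⇒injection (Group.setoid group)
          (proj₁ code-word , λ {w} {v} e → Pointwise-∼⇒≋ (proj₂ code-word {w} {v} e))
      }
      where
      code-word : Code Word (Pointwise _∼_)
      code-word = code-list code-generator

-- Alternating commutator chains in locally nilpotent groups.

module _ {ℓ : Level} (G : Group ℓ ℓ) where
  open Group G hiding (refl; sym; trans)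
  private module G = Group G

  Shifts : (ℕ → Carrier) → Bool → Carrier → Set ℓ
  Shifts η b y = ∀ n → parity n ≡ b → [_,_] G (η n) y ≈ η (suc n)

  shifts-incompatible : LocallyNilpotent G → ∀ η {y₀ y₁} → Shifts η false y₀ → Shifts η true y₁ →
                        ∃[ n ] η n ≈ ε
  shifts-incompatible ln η {y₀} {y₁} s₀ s₁ with ln (η 0 ∷ y₀ ∷ y₁ ∷ [])
  ... | n , trivial = n , trivial (η n , proj₁ (descends n)) (proj₂ (descends n))
    where
    S : Carrier → Set ℓ
    S g = Membership._∈_ setoid g (η 0 ∷ y₀ ∷ y₁ ∷ [])

    K = generatedSubgroup G S

    y : Bool → Carrier
    y false = y₀
    y true  = y₁

    y∈S : ∀ b → S (y b)
    y∈S false = there (here G.refl)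
    y∈S true  = there (there (here G.refl))

    shifts : ∀ n → [_,_] G (η n) (y (parity n)) ≈ η (suc n)
    shifts n with parity n in e
    ... | false = s₀ n e
    ... | true  = s₁ n e

    -- Membership is built together with the central series term, since an element of `K` carries
    -- its proof of membership. The step takes the commutator with whichever of y₀, y₁ fits the
    -- parity of n.
    descends : ∀ n → Σ[ g ∈ Generated G S (η n) ] lowerCentralSeries K n (η n , g)
    descends zero    = gen (here G.refl) , tt
    descends (suc n) with descends n
    ... | g , γ = resp (shifts n) (mul (mul (mul (inv g) (inv gy)) g) gy) ,
                  gen ((η n , g) , (y (parity n) , gy) , γ , G.sym (shifts n))
      where
      gy : Generated G S (y (parity n))
      gy = gen (y∈S (parity n))

  shifts-resp : ∀ {η θ b y} → (∀ n → η n ≈ θ n) → Shifts η b y → Shifts θ b y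
  shifts-resp {η} {θ} {b} {y} η≈θ s n par = G.trans
    (∙-congʳ (∙-cong (∙-congʳ (⁻¹-cong (G.sym (η≈θ n)))) (G.sym (η≈θ n))))
    (G.trans (s n par) (η≈θ (suc n)))

-- Diagonalising against embeddings into G.

module Diagonal {ℓ : Level} (em : ExcludedMiddle ℓ) (G : Group ℓ ℓ) where
  open Group G hiding (refl; sym; trans)
  private module G = Group G

  -- Unless some η n is trivial, no element of G shifts η at the levels of its colour.
  colour : (ℕ → Carrier) → Bool
  colour η = does (em {∃[ y ] Shifts G η false y})

  colour-cong : ∀ {η θ} → (∀ n → η n ≈ θ n) → colour η ≡ colour θ
  colour-cong {η} {θ} η≈θ with em {∃[ y ] Shifts G η false y} | em {∃[ y ] Shifts G θ false y}
  ... | yes _       | yes _       = refl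
  ... | no _        | no _        = refl
  ... | yes (y , s) | no none     = contradiction (y , shifts-resp G η≈θ s) none
  ... | no none     | yes (y , s) = contradiction (y , shifts-resp G (λ n → G.sym (η≈θ n)) s) none

  -- If the colour is `true`, some y₀ already shifts η at even levels and y shifts it at odd ones,
  -- so `shifts-incompatible` applies. If it is `false`, then y is what the colour denies.
  colour-diagonal : LocallyNilpotent G → ∀ η {y} → Shifts G η (colour η) y → ∃[ n ] η n ≈ ε
  colour-diagonal ln η {y} s with em {∃[ y ] Shifts G η false y}
  ... | yes (y₀ , s₀) = shifts-incompatible G ln η s₀ s
  ... | no none       = contradiction (y , s) none

  open TreeGroup em setoid colour colour-cong

  tree-unembeddable : LocallyNilpotent G → ¬ Embeds group G
  tree-unembeddable ln (f , mono) =
    let (n , ηn≈ε) = colour-diagonal ln η η-shifts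
    in x≉ε (prefix n) (injective (G.trans ηn≈ε (G.sym ε-homo)))
    where
    open GroupMorphisms (Group.rawGroup group) rawGroup using (module IsGroupMonomorphism)
    open IsGroupMonomorphism mono using (injective; ε-homo; ∙-homo; ⁻¹-homo; ⟦⟧-cong)

    -- The labels are elements of G, so the image of the node reached so far can serve as the next
    -- label; thus `prefix n` is the initial segment of η of length n.
    prefix : ℕ → Node
    prefix zero    = []
    prefix (suc n) = f (x (prefix n)) ∷ prefix n

    η : Branch
    η n = f (x (prefix n))

    length-prefix : ∀ n → length (prefix n) ≡ n
    length-prefix zero    = refl
    length-prefix (suc n) = cong suc (length-prefix n)

    prefix-on : ∀ n → On (prefix n) η
    prefix-on zero    = tt
    prefix-on (suc n) = G.reflexive (cong η (sym (length-prefix n))) , prefix-on n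

    commutator-homo : ∀ u v → f ([_,_] group u v) ≈ [_,_] G (f u) (f v)
    commutator-homo u v = G.trans (∙-homo _ v) (∙-congʳ (G.trans (∙-homo _ u) (∙-congʳ
      (G.trans (∙-homo _ _) (∙-cong (⁻¹-homo u) (⁻¹-homo v))))))

    η-shifts : Shifts G η (colour η) (f (y η))
    η-shifts n par = G.trans (G.sym (commutator-homo (x (prefix n)) (y η)))
      (G.trans
        (⟦⟧-cong ([x,y]≋x (prefix-on n , trans (cong parity (length-prefix n)) par)))
        -- `child` reads the label at `length (prefix n)`, which has to be rewritten to n before the
        -- node becomes `prefix (suc n)`.
        (G.reflexive (cong (λ m → f (x (η m ∷ prefix n))) (length-prefix n))))

theorem1p3 : ∀ {ℓ} → ExcludedMiddle ℓ →
    (κ : Cardinal ℓ) → Infinite κ → Bijection (Cardinal.setoid κ) (κ ^ℵ₀) →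
    ¬ (Σ[ G ∈ Group ℓ ℓ ] UniversalLN κ G)
theorem1p3 em κ infinite κ≅κ^ℵ₀ (G , G∈LN , universal) =
  -- The tree is labelled by G itself, so |G| ≤ κ puts its group in the class and universality would
  -- embed it.
  tree-unembeddable locallyNilpotent
    (universal _ (treeGroup∈LN (Group.setoid G) cardinality≤ colour colour-cong))
  where
  open LN G∈LN
  open Diagonal em G
  open Coding em κ infinite κ≅κ^ℵ₀
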